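{- The following two statements are equivalent: (a) Every 3-connected cubic graph $G$ admits a proper $5$-edge-coloring $c$ such that $|N_G(c)|\leq 7$. (b) There exists a sublinear function $f:\mathbb{N}\rightarrow\mathbb{N}$ such that every 3-connected cubic graph $G$ admits a proper $5$-edge-coloring $c$ with $|N_G(c)|\leq f(|V(G)|)$.
   Context: Graphs are finite, undirected, loopless, and may have parallel edges. A function $f:\mathbb{N}\to\mathbb{N}$ is sublinear if $\lim_{n\to+\infty} f(n)/n=0$. A proper $5$-edge-coloring assigns colors from $\{1,\dots,5\}$ to edges so that adjacent edges get different colors. For an edge-coloring $c$, $S_c(v)$ is the set of colors on edges incident to $v$. An edge $uv$ of a cubic graph is poor if $|S_c(u)\cup S_c(v)|=3$, rich if $|S_c(u)\cup S_c(v)|=5$, and abnormal otherwise. $N_G(c)$ is the set of abnormal edges of $G$ with respect to $c$. -}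

module Defs where

open import Data.Nat using (ℕ; zero; suc; _+_; _*_; _≤_; _<_)
open import Data.Fin using (Fin; _≟_)
open import Data.Fin.Subset using (Subset; _∈_; _∉_; _∪_; ∣_∣)
open import Data.Bool using (Bool; true; false; _∧_; _∨_; not)
open import Data.Nat using () renaming (_≟_ to _ℕ≟_)
open import Data.List using (List; []; _∷_)
open import Data.Bool.ListAction using (any)
open import Data.List.Base using ()
open import Data.Fin.Base using ()
open import Data.Vec using (tabulate)
open import Data.List using () renaming (map to lmap)
open import Data.Product using (Σ; ∃; _×_; _,_; proj₁; proj₂)
open import Data.Sum using (_⊎_)
open import Relation.Nullary using (¬_; Dec; does)
open import Relation.Binary.PropositionalEquality using (_≡_; _≢_)
import Data.List as L
open import Data.Fin using () renaming (toℕ to toℕ)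
import Data.List.Base as LB

allFin : (k : ℕ) → List (Fin k)
allFin k = LB.tabulate (λ i → i)

count : ∀ {A : Set} → (A → Bool) → List A → ℕ
count p [] = 0
count p (x ∷ xs) with p x
... | true  = suc (count p xs)
... | false = count p xs

-- A finite loopless multigraph: vertices Fin n, edges Fin m (parallel edges allowed).
record Graph : Set where
  field
    n        : ℕ
    m        : ℕ
    ends     : Fin m → Fin n × Fin n
    loopless : ∀ e → proj₁ (ends e) ≢ proj₂ (ends e)

module _ (G : Graph) where
  open Graph G

  incident : Fin m → Fin n → Bool
  incident e v = does (proj₁ (ends e) ≟ v) ∨ does (proj₂ (ends e) ≟ v)

  degree : Fin n → ℕ
  degree v = count  (λ e → incident e v) (allFin m)

  Cubic : Set
  Cubic = ∀ v → degree v ≡ 3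

  data Reach (X : Subset n) : Fin n → Fin n → Set where
    here : ∀ {u} → u ∉ X → Reach X u u
    step : ∀ {u v} (e : Fin m) → proj₁ (ends e) ∉ X → proj₂ (ends e) ∉ X →
           ((proj₁ (ends e) ≡ u × proj₂ (ends e) ≡ v) ⊎ (proj₂ (ends e) ≡ u × proj₁ (ends e) ≡ v)) →
           ∀ {w} → Reach X v w → Reach X u w

  -- Diestel: G is k-connected if |V(G)| > k and G − X is connected for all X with |X| < k.
  ThreeConnected : Set
  ThreeConnected = 3 < n × (∀ (X : Subset n) → ∣ X ∣ < 3 → ∀ u v → u ∉ X → v ∉ X → Reach X u v)

  EdgeColoring5 : Set
  EdgeColoring5 = Fin m → Fin 5

  Proper : EdgeColoring5 → Set
  Proper c = ∀ e e' v → e ≢ e' → incident e v ≡ true → incident e' v ≡ true → c e ≢ c e'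

  S : EdgeColoring5 → Fin n → Subset 5
  S c v = tabulate (λ k → any (λ e → incident e v ∧ does (c e ≟ k)) (allFin m))

  unionSize : EdgeColoring5 → Fin m → ℕ
  unionSize c e = ∣ S c (proj₁ (ends e)) ∪ S c (proj₂ (ends e)) ∣

  Poor Rich Abnormal : EdgeColoring5 → Fin m → Set
  Poor c e = unionSize c e ≡ 3
  Rich c e = unionSize c e ≡ 5
  Abnormal c e = ¬ Poor c e × ¬ Rich c e

  abnormalCount : EdgeColoring5 → ℕ
  abnormalCount c = count  (λ e → not (does (unionSize c e ℕ≟ 3)) ∧ not (does (unionSize c e ℕ≟ 5))) (allFin m)

-- f(n)/n → 0, written over ℕ: for every k ≥ 1, eventually k * f n ≤ n.
Sublinear : (ℕ → ℕ) → Set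
Sublinear f = ∀ k → ∃ λ N → ∀ n → N ≤ n → suc k * f n ≤ n

StatementA : Set
StatementA = ∀ (G : Graph) → Cubic G → ThreeConnected G →
  Σ (EdgeColoring5 G) λ c → Proper G c × abnormalCount G c ≤ 7

StatementB : Set
StatementB = Σ (ℕ → ℕ) λ f → Sublinear f ×
  (∀ (G : Graph) → Cubic G → ThreeConnected G →
    Σ (EdgeColoring5 G) λ c → Proper G c × abnormalCount G c ≤ f (Graph.n G))

-- A constant bound is sublinear.  Conversely, let G be a 3-connected cubic
-- graph with w + 1 vertices and B another one with N vertices.  Replacing
-- every vertex of B by a copy of G minus a root gives a 3-connected cubic
-- graph B[G] with N w vertices, and iterating this construction from G
-- makes N as large as desired.  If B[G] has fewer than N abnormal edges,
-- which a sublinear bound guarantees for large N, then in some copy no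
-- edge is abnormal.  Carry the colours of this copy over to G and recolour
-- two of the three root edges greedily: only edges at the root or at the
-- other ends of these two edges can be abnormal, and there are at most
-- 3 + 2 + 2 of them.

module Submission where

open import Defs
open import Data.Nat using (ℕ; zero; suc; _+_; _*_; _≤_; _<_; z≤n; s≤s; z<s; >-nonZero)
import Data.Nat.Properties as ℕ
open import Data.Fin using (Fin; zero; suc; _≟_; _<?_; punchIn; punchOut; combine; remQuot)
import Data.Fin as Fin
open import Data.Fin.Properties
  using (suc-injective; inject≤-injective; any?; all?; ¬∀⟶∃¬; injective⇒≤; punchIn-punchOut;
         remQuot-combine; combine-remQuot; <-cmp; <-asym)
open import Data.Fin.Subset using (Subset; _∪_; ∣_∣; ⁅_⁆; inside; outside) renaming (_∈_ to _∈ₛ_; _∉_ to _∉ₛ_)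
open import Data.Fin.Subset.Properties using (p⊆q⇒∣p∣≤∣q∣; ∣⁅x⁆∣≡1; x∈p∪q⁺; x∈⁅x⁆; ∪-comm)
open import Data.Bool using (Bool; true; false; _∧_; not)
import Data.Bool.Properties as Bool
open import Data.Bool.ListAction using (any)
open import Data.List using (List; []; _∷_; length; lookup; tabulate; map; _++_)
open import Data.List.Properties using (length-map)
open import Data.List.Membership.Propositional using (_∈_; _∉_; lose)
import Data.List.Membership.DecPropositional as DecMembership
import Data.List.Membership.Propositional.Properties as ∈ₗ
import Data.List.Relation.Unary.Any as Any
open import Data.List.Relation.Unary.Any using (here; there)
import Data.List.Relation.Unary.Any.Properties as Anyₚ
import Data.Vec as Vec
import Data.Vec.Properties as Vecₚ
open import Data.Product using (Σ; ∃; _×_; _,_; proj₁; proj₂)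
open import Data.Product.Properties using (≡-dec)
open import Data.Sum using (_⊎_; inj₁; inj₂; [_,_]′)
open import Data.Empty using (⊥)
open import Data.Unit using (⊤; tt)
open import Function using (_∘_; id)
open import Function.Bundles using (_⇔_; mk⇔; Equivalence)
open import Function.Definitions using (Injective)
open import Relation.Binary.Definitions using (DecidableEquality; tri<; tri≈; tri>)
open import Relation.Binary.PropositionalEquality
open import Relation.Binary.Construct.Closure.ReflexiveTransitive using (Star; ε; _◅_; _◅◅_; gmap; reverse)
open import Relation.Nullary using (¬_; Dec; yes; no; does)
open import Relation.Nullary.Decidable using (does-⇔; dec-true; dec-false; ¬?; _×-dec_; _⊎-dec_; _→-dec_; from-yes; decidable-stable)
open import Relation.Nullary.Negation using (contradiction)

-- The class of an edge depends only on the colours at its two ends. Each root edge inherits the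
-- colour of the edge leaving the block at the corresponding vertex, so all palettes away from the
-- root are copied unchanged and only the three colours at the root may clash. Five colours suffice
-- for the repair because an edge of a cubic graph has at most four adjacent edges. The third root
-- edge keeps its colour, which is why its far end contributes nothing to the seven.
--
-- Sublinearity enters through the factor w + 1: from (w + 1) f(N w) <= N w it follows that f(N w) <
-- N. Edges inside different blocks are different, so fewer than N abnormal edges miss some block.
--
-- The main obstacle is that B[G] is again 3-connected. Two deleted vertices touch at most two
-- blocks; every surviving vertex has to reach an untouched block, and the untouched blocks hang
-- together because B minus two vertices is connected. Working with darts avoids any numbering of
-- the edges of B[G]: substitution becomes a formula for the involution.

-- Pigeonhole and counting.

module _ {A : Set} (_≟A_ : DecidableEquality A) where
  open DecMembership _≟A_ using (_∈?_)

  -- If every value were in `xs`, their positions would inject `Fin k` into `Fin (length xs)`;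
  -- decidable membership turns this failure into a witness.
  outside-list : ∀ {k} {f : Fin k → A} → Injective _≡_ _≡_ f →
                 ∀ xs → length xs < k → ∃ λ i → f i ∉ xs
  outside-list {k} {f} f-inj xs short = ¬∀⟶∃¬ k _ (λ i → f i ∈? xs) covered
    where
    covered : ¬ (∀ i → f i ∈ xs)
    covered f∈ = ℕ.<⇒≱ short (injective⇒≤ index-inj)
      where
      index-inj : Injective _≡_ _≡_ (λ i → Any.index (f∈ i))
      index-inj {i} {j} eq = f-inj (trans (Anyₚ.lookup-index (f∈ i))
        (trans (cong (lookup xs) eq) (sym (Anyₚ.lookup-index (f∈ j)))))

outside-Fin : ∀ {k} (xs : List (Fin k)) → length xs < k → ∃ λ i → i ∉ xs
outside-Fin = outside-list _≟_ id

-- A bijective listing of the solutions of `p`. It lets counts be compared through injections,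
-- without the recursion over the edge list.
record Enumeration {A : Set} (p : A → Bool) (k : ℕ) : Set where
  field
    at        : Fin k → A
    at-true   : ∀ i → p (at i) ≡ true
    index     : ∀ {a} → p a ≡ true → ∃ λ i → at i ≡ a
    injective : Injective _≡_ _≡_ at

enumerate-tabulate : ∀ {A : Set} (q : A → Bool) {m} (f : Fin m → A) →
                     Enumeration (q ∘ f) (count q (tabulate f))
enumerate-tabulate q {zero} f = record
  { at = λ () ; at-true = λ () ; index = λ { {()} } ; injective = λ { {()} } }
enumerate-tabulate q {suc m} f with q (f zero) in q0 | enumerate-tabulate q (f ∘ suc)
... | true | E = record
  { at = at′
  ; at-true = λ { zero → q0 ; (suc i) → at-true i }
  ; index = λ { {zero} _ → zero , refl
              ; {suc a} qa → suc (proj₁ (index qa)) , cong suc (proj₂ (index qa)) }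
  ; injective = inj }
  where
  open Enumeration E
  at′ : Fin (suc _) → Fin (suc m)
  at′ zero = zero
  at′ (suc i) = suc (at i)
  inj : Injective _≡_ _≡_ at′
  inj {zero} {zero} _ = refl
  inj {zero} {suc _} ()
  inj {suc _} {zero} ()
  inj {suc i} {suc j} eq = cong suc (injective (suc-injective eq))
... | false | E = record
  { at = suc ∘ at
  ; at-true = at-true
  ; index = λ { {zero} q0′ → contradiction (trans (sym q0) q0′) λ ()
              ; {suc a} qa → proj₁ (index qa) , cong suc (proj₂ (index qa)) }
  ; injective = injective ∘ suc-injective }
  where open Enumeration E

enumerate : ∀ {m} (p : Fin m → Bool) → Enumeration p (count p (allFin m))
enumerate p = enumerate-tabulate p id

enumeration-≤ : ∀ {A B : Set} {p : A → Bool} {q : B → Bool} {k l} → Enumeration p k → Enumeration q l →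
                (f : ∀ a → p a ≡ true → B) → (∀ a pa → q (f a pa) ≡ true) →
                (∀ a pa a′ pa′ → f a pa ≡ f a′ pa′ → a ≡ a′) → k ≤ l
enumeration-≤ {A} {B} {q = q} {k} {l} E F f qf f-inj = injective⇒≤ {f = g} g-inj
  where
  module E = Enumeration E
  module F = Enumeration F
  g : Fin k → Fin l
  g i = proj₁ (F.index (qf (E.at i) (E.at-true i)))
  at-g : ∀ i → F.at (g i) ≡ f (E.at i) (E.at-true i)
  at-g i = proj₂ (F.index (qf (E.at i) (E.at-true i)))
  g-inj : Injective _≡_ _≡_ g
  g-inj {i} {j} eq = E.injective (f-inj _ _ _ _ (trans (sym (at-g i)) (trans (cong F.at eq) (at-g j))))

count-unique : ∀ {m k} {p : Fin m → Bool} → Enumeration p k → count p (allFin m) ≡ k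
count-unique {p = p} E = ℕ.≤-antisym (compare (enumerate p) E) (compare E (enumerate p))
  where
  compare : ∀ {k l} → Enumeration p k → Enumeration p l → k ≤ l
  compare E F = enumeration-≤ E F (λ a _ → a) (λ _ pa → pa) (λ _ _ _ _ eq → eq)

injective⇒≤count : ∀ {m k} (p : Fin m → Bool) (g : Fin k → Fin m) → Injective _≡_ _≡_ g →
                   (∀ i → p (g i) ≡ true) → k ≤ count p (allFin m)
injective⇒≤count {k = k} p g g-inj pg = enumeration-≤ everything (enumerate p) (λ i _ → g i)
  (λ i _ → pg i) (λ _ _ _ _ → g-inj)
  where
  everything : Enumeration {Fin k} (λ _ → true) k
  everything = record { at = id ; at-true = λ _ → refl ; index = λ {a} _ → a , refl ; injective = id }

count≤length : ∀ {m} (p : Fin m → Bool) (xs : List (Fin m)) →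
               (∀ e → p e ≡ true → e ∈ xs) → count p (allFin m) ≤ length xs
count≤length p xs p⊆xs = injective⇒≤ {f = λ i → Any.index (at∈ i)} λ {i} {j} eq →
  injective (trans (Anyₚ.lookup-index (at∈ i))
    (trans (cong (lookup xs) eq) (sym (Anyₚ.lookup-index (at∈ j)))))
  where
  open Enumeration (enumerate p)
  at∈ : ∀ i → at i ∈ xs
  at∈ i = p⊆xs (at i) (at-true i)

-- Cubic multigraphs as darts with an involution.

Dart : Set → Set
Dart V = V × Fin 3

-- A cubic loopless multigraph on V: three darts leave each vertex, and
-- an edge is an orbit of the involution mate.
record DartGraph (V : Set) : Set where
  field
    mate          : Dart V → Dart V
    mate-mate     : ∀ d → mate (mate d) ≡ d
    mate-loopless : ∀ d → proj₁ (mate d) ≢ proj₁ d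

  mate-injective : ∀ {d d′} → mate d ≡ mate d′ → d ≡ d′
  mate-injective {d} {d′} eq = trans (sym (mate-mate d)) (trans (cong mate eq) (mate-mate d′))

  neighbour : V → Fin 3 → V
  neighbour v i = proj₁ (mate (v , i))

  Linked : (V → Bool) → V → V → Set
  Linked live = Star λ u v → live u ≡ true × live v ≡ true × ∃ λ i → neighbour u i ≡ v

  link-sym : ∀ {live u v} → Linked live u v → Linked live v u
  link-sym = reverse λ { {u} (lu , lv , i , refl) →
    lv , lu , proj₂ (mate (u , i)) , cong proj₁ (mate-mate (u , i)) }

  -- The deleted set is any set contained in some {x , y}.
  TriplyConnected : Set
  TriplyConnected = ∀ (live : V → Bool) x y → (∀ v → v ≢ x → v ≢ y → live v ≡ true) →
                    ∀ {u v} → live u ≡ true → live v ≡ true → Linked live u v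

-- Presenting a graph by its darts.

Joins : (G : Graph) → Fin (Graph.m G) → Fin (Graph.n G) → Fin (Graph.n G) → Set
Joins G e u v = (proj₁ (ends e) ≡ u × proj₂ (ends e) ≡ v) ⊎ (proj₂ (ends e) ≡ u × proj₁ (ends e) ≡ v)
  where open Graph G

module _ (G : Graph) where
  open Graph G

  incident⇒end : ∀ e v → incident G e v ≡ true → proj₁ (ends e) ≡ v ⊎ proj₂ (ends e) ≡ v
  incident⇒end e v inc with proj₁ (ends e) ≟ v | proj₂ (ends e) ≟ v
  ... | yes p | _     = inj₁ p
  ... | no _  | yes q = inj₂ q
  incident⇒end e v () | no _ | no _

  joins⇒incident : ∀ {e u v} → Joins G e u v → incident G e u ≡ true
  joins⇒incident {e} {u} (inj₁ (p , _)) rewrite dec-true (proj₁ (ends e) ≟ u) p = refl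
  joins⇒incident {e} {u} (inj₂ (q , _)) rewrite dec-true (proj₂ (ends e) ≟ u) q =
    Bool.∨-zeroʳ (does (proj₁ (ends e) ≟ u))

  joins-sym : ∀ {e u v} → Joins G e u v → Joins G e v u
  joins-sym (inj₁ (p , q)) = inj₂ (q , p)
  joins-sym (inj₂ (p , q)) = inj₁ (q , p)

  joins-functional : ∀ {e u v w} → Joins G e u v → Joins G e u w → v ≡ w
  joins-functional (inj₁ (_ , q)) (inj₁ (_ , q′)) = trans (sym q) q′
  joins-functional (inj₂ (_ , q)) (inj₂ (_ , q′)) = trans (sym q) q′
  joins-functional {e} (inj₁ (p , _)) (inj₂ (p′ , _)) = contradiction (trans p (sym p′)) (loopless e)
  joins-functional {e} (inj₂ (p , _)) (inj₁ (p′ , _)) = contradiction (trans p′ (sym p)) (loopless e)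

  incidents⇒joins : ∀ {e u v} → u ≢ v → incident G e u ≡ true → incident G e v ≡ true → Joins G e u v
  incidents⇒joins {e} {u} {v} u≢v eu ev with incident⇒end e u eu | incident⇒end e v ev
  ... | inj₁ p | inj₂ q = inj₁ (p , q)
  ... | inj₂ p | inj₁ q = inj₂ (p , q)
  ... | inj₁ p | inj₁ q = contradiction (trans (sym p) q) u≢v
  ... | inj₂ p | inj₂ q = contradiction (trans (sym p) q) u≢v

  opposite : ∀ e v → incident G e v ≡ true → ∃ λ u → Joins G e v u
  opposite e v ev with incident⇒end e v ev
  ... | inj₁ p = proj₂ (ends e) , inj₁ (p , refl)
  ... | inj₂ p = proj₁ (ends e) , inj₂ (p , refl)

-- Stated as a relation because it arises both ways, from a given cubic graph and from a constructed
-- dart graph; the translation of connectivity and colourings then refers to neither construction.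
record Presentation (G : Graph) (D : DartGraph (Fin (Graph.n G))) : Set where
  open Graph G
  open DartGraph D
  field
    edge           : Dart (Fin n) → Fin m
    edge-incident  : ∀ d → incident G (edge d) (proj₁ d) ≡ true
    edge-complete  : ∀ {e v} → incident G e v ≡ true → ∃ λ i → edge (v , i) ≡ e
    edge-injective : ∀ {v i j} → edge (v , i) ≡ edge (v , j) → i ≡ j
    edge-mate      : ∀ d → edge (mate d) ≡ edge d

  edge-joins : ∀ d → Joins G (edge d) (proj₁ d) (proj₁ (mate d))
  edge-joins d = incidents⇒joins G (mate-loopless d ∘ sym) (edge-incident d)
    (trans (cong (λ e → incident G e (proj₁ (mate d))) (sym (edge-mate d))) (edge-incident (mate d)))

  joins⇒dart : ∀ {e u v} → Joins G e u v → ∃ λ i → edge (u , i) ≡ e × neighbour u i ≡ v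
  joins⇒dart {e} {u} {v} j with edge-complete (joins⇒incident G j)
  ... | i , refl = i , refl , joins-functional G (edge-joins (u , i)) j

  dart : ∀ e → ∃ λ d → edge d ≡ e
  dart e with joins⇒dart {e} (inj₁ (refl , refl))
  ... | i , eq , _ = (proj₁ (ends e) , i) , eq

  -- At a common vertex the darts agree by injectivity. Otherwise they sit at the two ends of the
  -- edge, and injectivity at `u` identifies the mate.
  edge-orbit : ∀ {d d′} → edge d ≡ edge d′ → d ≡ d′ ⊎ d ≡ mate d′
  edge-orbit {u , i} {v , j} eq
    with u ≟ v
  ... | yes refl = inj₁ (cong (u ,_) (edge-injective eq))
  ... | no u≢v = inj₂ (sym mate≡)
    where
    neighbour≡u : neighbour v j ≡ u
    neighbour≡u = joins-functional G (edge-joins (v , j))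
      (incidents⇒joins G (u≢v ∘ sym) (edge-incident (v , j))
        (subst (λ e → incident G e u ≡ true) eq (edge-incident (u , i))))
    mate≡ : mate (v , j) ≡ (u , i)
    mate≡ with mate (v , j) | edge-mate (v , j) | neighbour≡u
    ... | _ , k | em | refl = cong (u ,_) (edge-injective (trans em (sym eq)))

  cubic : Cubic G
  cubic v = count-unique record
    { at        = λ i → edge (v , i)
    ; at-true   = λ i → edge-incident (v , i)
    ; index     = edge-complete
    ; injective = edge-injective }

module _ (G : Graph) (cubicG : Cubic G) where
  open Graph G

  private
    incidences : ∀ v → Enumeration (λ e → incident G e v) 3
    incidences v = subst (Enumeration (λ e → incident G e v)) (cubicG v) (enumerate (λ e → incident G e v))

    module I v = Enumeration (incidences v)

    edge : Dart (Fin n) → Fin m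
    edge (v , i) = I.at v i

    across : ∀ d → ∃ λ d′ → Joins G (edge d) (proj₁ d) (proj₁ d′) × edge d′ ≡ edge d
    across (v , i) with opposite G (I.at v i) v (I.at-true v i)
    ... | u , j with I.index u (joins⇒incident G (joins-sym G j))
    ... | k , eq = (u , k) , j , eq

    mate : Dart (Fin n) → Dart (Fin n)
    mate d = proj₁ (across d)

    mate-joins : ∀ d → Joins G (edge d) (proj₁ d) (proj₁ (mate d))
    mate-joins d = proj₁ (proj₂ (across d))

    mate-edge : ∀ d → edge (mate d) ≡ edge d
    mate-edge d = proj₂ (proj₂ (across d))

    same-dart : ∀ {d d′} → proj₁ d ≡ proj₁ d′ → edge d ≡ edge d′ → d ≡ d′
    same-dart {v , _} refl eq = cong (v ,_) (I.injective v eq)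

    joins-loopless : ∀ {e u v} → Joins G e u v → v ≢ u
    joins-loopless {e} (inj₁ (p , q)) eq = loopless e (trans p (trans (sym eq) (sym q)))
    joins-loopless {e} (inj₂ (p , q)) eq = loopless e (trans q (trans eq (sym p)))

  toDartGraph : DartGraph (Fin n)
  toDartGraph = record
    { mate = mate
    ; mate-mate = λ d → same-dart
        (joins-functional G (mate-joins (mate d))
          (subst (λ e → Joins G e (proj₁ (mate d)) (proj₁ d)) (sym (mate-edge d)) (joins-sym G (mate-joins d))))
        (trans (mate-edge (mate d)) (mate-edge d))
    ; mate-loopless = λ d → joins-loopless (mate-joins d) }

  toDartGraph-presentation : Presentation G toDartGraph
  toDartGraph-presentation = record
    { edge = edge
    ; edge-incident = λ (v , i) → I.at-true v i
    ; edge-complete = λ {_} {v} → I.index v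
    ; edge-injective = λ {v} → I.injective v
    ; edge-mate = mate-edge }

-- Distinct neighbours from 3-connectedness.

third-index? : Dec (∀ (i j : Fin 3) → i ≢ j → ∃ λ k → ∀ l → l ≡ i ⊎ l ≡ j ⊎ l ≡ k)
third-index? = all? λ i → all? λ j → ¬? (i ≟ j) →-dec
  any? λ k → all? λ l → (l ≟ i) ⊎-dec ((l ≟ j) ⊎-dec (l ≟ k))

third-index : ∀ (i j : Fin 3) → i ≢ j → ∃ λ k → ∀ l → l ≡ i ⊎ l ≡ j ⊎ l ≡ k
third-index = from-yes third-index?

module _ {V : Set} (_≟V_ : DecidableEquality V) where

  except : V → V → V → Bool
  except x y v = not (does (v ≟V x)) ∧ not (does (v ≟V y))

  except-true : ∀ {x y v} → v ≢ x → v ≢ y → except x y v ≡ true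
  except-true {x} {y} {v} v≢x v≢y rewrite dec-false (v ≟V x) v≢x | dec-false (v ≟V y) v≢y = refl

  except-≢ : ∀ {x y v} → except x y v ≡ true → v ≢ x × v ≢ y
  except-≢ {x} {y} {v} eq with v ≟V x | v ≟V y
  ... | no v≢x | no v≢y = v≢x , v≢y
  except-≢ () | yes _ | _
  except-≢ () | no _ | yes _

  -- If two of the three neighbours of v coincide, the at most two
  -- neighbours separate v from any fourth vertex.
  neighbour-injective : (D : DartGraph V) → DartGraph.TriplyConnected D →
                        {f : Fin 4 → V} → Injective _≡_ _≡_ f →
                        ∀ {v i j} → DartGraph.neighbour D v i ≡ DartGraph.neighbour D v j → i ≡ j
  neighbour-injective D connected {f} f-inj {v} {i} {j} eq = decidable-stable (i ≟ j) λ i≢j →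
    let k , all-indices = third-index i j i≢j
        x = neighbour v i
        y = neighbour v k
        a , fa∉ = outside-list _≟V_ f-inj (v ∷ x ∷ y ∷ []) (s≤s (s≤s (s≤s (s≤s z≤n))))
        dead : ∀ l → ¬ (except x y (neighbour v l) ≡ true)
        dead l live = [ (λ e → proj₁ (except-≢ live) (cong (neighbour v) e))
                      , [ (λ e → proj₁ (except-≢ live) (trans (cong (neighbour v) e) (sym eq)))
                        , (λ e → proj₂ (except-≢ live) (cong (neighbour v) e)) ]′ ]′ (all-indices l)
        stuck : ∀ {u} → v ≢ u → ¬ Linked (except x y) v u
        stuck = λ { v≢u ε → v≢u refl ; _ ((_ , live , l , refl) ◅ _) → dead l live }
    in stuck (λ v≡fa → fa∉ (here (sym v≡fa)))
         (connected (except x y) x y (λ _ → except-true)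
           (except-true (mate-loopless (v , i) ∘ sym) (mate-loopless (v , k) ∘ sym))
           (except-true (λ e → fa∉ (there (here e))) (λ e → fa∉ (there (there (here e))))))
    where open DartGraph D

-- Deleted sets: small subsets against pairs of vertices.

∣p∪q∣≤∣p∣+∣q∣ : ∀ {n} (p q : Subset n) → ∣ p ∪ q ∣ ≤ ∣ p ∣ + ∣ q ∣
∣p∪q∣≤∣p∣+∣q∣ Vec.[] Vec.[] = z≤n
∣p∪q∣≤∣p∣+∣q∣ (outside Vec.∷ p) (outside Vec.∷ q) = ∣p∪q∣≤∣p∣+∣q∣ p q
∣p∪q∣≤∣p∣+∣q∣ (outside Vec.∷ p) (inside  Vec.∷ q) =
  subst (suc ∣ p ∪ q ∣ ≤_) (sym (ℕ.+-suc ∣ p ∣ ∣ q ∣)) (s≤s (∣p∪q∣≤∣p∣+∣q∣ p q))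
∣p∪q∣≤∣p∣+∣q∣ (inside  Vec.∷ p) (outside Vec.∷ q) = s≤s (∣p∪q∣≤∣p∣+∣q∣ p q)
∣p∪q∣≤∣p∣+∣q∣ (inside  Vec.∷ p) (inside  Vec.∷ q) =
  s≤s (ℕ.≤-trans (∣p∪q∣≤∣p∣+∣q∣ p q) (ℕ.+-monoʳ-≤ ∣ p ∣ (ℕ.n≤1+n ∣ q ∣)))

elements : ∀ {n} → Subset n → List (Fin n)
elements Vec.[]              = []
elements (outside Vec.∷ p) = map suc (elements p)
elements (inside  Vec.∷ p) = zero ∷ map suc (elements p)

length-elements : ∀ {n} (p : Subset n) → length (elements p) ≡ ∣ p ∣
length-elements Vec.[]              = refl
length-elements (outside Vec.∷ p) = trans (length-map suc (elements p)) (length-elements p)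
length-elements (inside  Vec.∷ p) = cong suc (trans (length-map suc (elements p)) (length-elements p))

∈-elements : ∀ {n} (p : Subset n) {v} → v ∈ₛ p → v ∈ elements p
∈-elements (_       Vec.∷ p) Vec.here        = here refl
∈-elements (outside Vec.∷ p) (Vec.there v∈p) = ∈ₗ.∈-map⁺ suc (∈-elements p v∈p)
∈-elements (inside  Vec.∷ p) (Vec.there v∈p) = there (∈ₗ.∈-map⁺ suc (∈-elements p v∈p))

-- The two names need neither be distinct nor lie in the list, since `TriplyConnected` asks only
-- that all other vertices be live. The argument `a` supplies a name when the list is empty.
at-most-two : ∀ {A : Set} → A → (xs : List A) → length xs < 3 →
              ∃ λ x → ∃ λ y → ∀ v → v ∈ xs → v ≡ x ⊎ v ≡ y
at-most-two a []           _ = a , a , λ _ ()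
at-most-two a (x ∷ [])     _ = x , x , λ { _ (here eq) → inj₁ eq }
at-most-two a (x ∷ y ∷ []) _ = x , y , λ { _ (here eq) → inj₁ eq ; _ (there (here eq)) → inj₂ eq }
at-most-two a (_ ∷ _ ∷ _ ∷ _) (s≤s (s≤s (s≤s ())))

not-true : ∀ {b} → ¬ (b ≡ true) → not b ≡ true
not-true {true}  ≢true = contradiction refl ≢true
not-true {false} _     = refl

not-true⁻ : ∀ {b} → not b ≡ true → ¬ (b ≡ true)
not-true⁻ {true} () _
not-true⁻ {false} _ ()

module _ {G : Graph} {D : DartGraph (Fin (Graph.n G))} (P : Presentation G D) where
  open Graph G
  open DartGraph D
  open Presentation P

  triplyConnected⇒threeConnected : 3 < n → TriplyConnected → ThreeConnected G
  triplyConnected⇒threeConnected 3<n connected = 3<n , reach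
    where
    reach : ∀ (X : Subset n) → ∣ X ∣ < 3 → ∀ u v → u ∉ₛ X → v ∉ₛ X → Reach G X u v
    reach X small u v u∉X v∉X
      with x , y , X⊆ ← at-most-two u (elements X) (subst (_< 3) (sym (length-elements X)) small)
      = walk v∉X (connected live x y
          (λ w w≢x w≢y → live⁺ λ w∈X → [ w≢x , w≢y ]′ (X⊆ w (∈-elements X w∈X)))
          (live⁺ u∉X) (live⁺ v∉X))
      where
      live : Fin n → Bool
      live w = not (Vec.lookup X w)
      live⁺ : ∀ {w} → w ∉ₛ X → live w ≡ true
      live⁺ {w} w∉X = not-true λ eq → w∉X (Vecₚ.lookup⇒[]= w X eq)
      live⁻ : ∀ {w} → live w ≡ true → w ∉ₛ X
      live⁻ {w} eq w∈X = not-true⁻ eq (Vecₚ.[]=⇒lookup w∈X)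
      walk : ∀ {u v} → v ∉ₛ X → Linked live u v → Reach G X u v
      walk v∉X ε = here v∉X
      walk {u} v∉X ((lu , lw , i , refl) ◅ p) with edge-joins (u , i)
      ... | inj₁ (eq , eq′) = step (edge (u , i)) (live⁻ (trans (cong live eq) lu))
              (live⁻ (trans (cong live eq′) lw)) (inj₁ (eq , eq′)) (walk v∉X p)
      ... | inj₂ (eq , eq′) = step (edge (u , i)) (live⁻ (trans (cong live eq′) lw))
              (live⁻ (trans (cong live eq) lu)) (inj₂ (eq , eq′)) (walk v∉X p)

  threeConnected⇒triplyConnected : ThreeConnected G → TriplyConnected
  threeConnected⇒triplyConnected (_ , reach) live x y only-xy {u} {v} lu lv =
    walk (reach X small u v (∉X lu) (∉X lv))
    where
    X : Subset n
    X = Vec.tabulate (not ∘ live)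
    ∉X : ∀ {w} → live w ≡ true → w ∉ₛ X
    ∉X {w} lw w∈X = not-true⁻ (trans (sym (Vecₚ.lookup∘tabulate (not ∘ live) w)) (Vecₚ.[]=⇒lookup w∈X)) lw
    ∉X⁻ : ∀ {w} → w ∉ₛ X → live w ≡ true
    ∉X⁻ {w} w∉X = decidable-stable (live w Bool.≟ true) λ dead →
      w∉X (Vecₚ.lookup⇒[]= w X (trans (Vecₚ.lookup∘tabulate (not ∘ live) w) (not-true dead)))
    X⊆ : ∀ {w} → w ∈ₛ X → w ∈ₛ ⁅ x ⁆ ∪ ⁅ y ⁆
    X⊆ {w} w∈X with w ≟ x | w ≟ y
    ... | yes refl | _ = x∈p∪q⁺ (inj₁ (x∈⁅x⁆ x))
    ... | no _ | yes refl = x∈p∪q⁺ {q = ⁅ y ⁆} (inj₂ (x∈⁅x⁆ y))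
    ... | no w≢x | no w≢y = contradiction w∈X (∉X (only-xy w w≢x w≢y))
    small : ∣ X ∣ < 3
    small = s≤s (ℕ.≤-trans (p⊆q⇒∣p∣≤∣q∣ X⊆) (ℕ.≤-trans (∣p∪q∣≤∣p∣+∣q∣ ⁅ x ⁆ ⁅ y ⁆)
      (ℕ.≤-reflexive (cong₂ _+_ (∣⁅x⁆∣≡1 x) (∣⁅x⁆∣≡1 y)))))
    walk : ∀ {u v} → Reach G X u v → Linked live u v
    walk (here _) = ε
    walk (step e p∉ q∉ (inj₁ (refl , refl)) r) with joins⇒dart {e} (inj₁ (refl , refl))
    ... | i , _ , eq = (∉X⁻ p∉ , ∉X⁻ q∉ , i , eq) ◅ walk r
    walk (step e p∉ q∉ (inj₂ (refl , refl)) r) with joins⇒dart {e} (inj₂ (refl , refl))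
    ... | i , _ , eq = (∉X⁻ q∉ , ∉X⁻ p∉ , i , eq) ◅ walk r

-- A graph realising a given dart structure.

module _ {n : ℕ} (D : DartGraph (Fin n)) where
  open DartGraph D

  private
    -- Each edge is represented by its dart leaving the smaller end.
    forward : Dart (Fin n) → Bool
    forward d = does (proj₁ d <? proj₁ (mate d))

    module E = Enumeration (enumerate (forward ∘ remQuot {n} 3))

    tail : ∀ x → Dart (Fin n)
    tail e = remQuot {n} 3 (E.at e)

    code : Dart (Fin n) → Fin (n * 3)
    code (v , i) = combine v i

    code-injective : ∀ {d d′} → code d ≡ code d′ → d ≡ d′
    code-injective {v , i} {v′ , i′} eq = trans (sym (remQuot-combine v i))
      (trans (cong (remQuot {n} 3) eq) (remQuot-combine v′ i′))

    forward-code : ∀ d → proj₁ d Fin.< proj₁ (mate d) → forward (remQuot {n} 3 (code d)) ≡ true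
    forward-code (v , i) lt = trans (cong forward (remQuot-combine v i)) (dec-true (v <? neighbour v i) lt)

    index : ∀ d → proj₁ d Fin.< proj₁ (mate d) → ∃ λ e → tail e ≡ d
    index (v , i) lt with E.index {code (v , i)} (forward-code (v , i) lt)
    ... | e , eq = e , trans (cong (remQuot {n} 3) eq) (remQuot-combine v i)

    tail-injective : ∀ {e e′} → tail e ≡ tail e′ → e ≡ e′
    tail-injective {e} {e′} eq = E.injective (trans (sym (combine-remQuot {n} 3 (E.at e)))
      (trans (cong code eq) (combine-remQuot {n} 3 (E.at e′))))

    tail-forward : ∀ e → proj₁ (tail e) Fin.< proj₁ (mate (tail e))
    tail-forward e = decidable-stable (_ <? _) λ not-less →
      contradiction (trans (sym (E.at-true e)) (dec-false (_ <? _) not-less)) λ ()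

    located : ∀ d → ∃ λ e → tail e ≡ d ⊎ tail e ≡ mate d
    located d with <-cmp (proj₁ d) (proj₁ (mate d))
    ... | tri< lt _ _ = proj₁ (index d lt) , inj₁ (proj₂ (index d lt))
    ... | tri≈ _ eq _ = contradiction (sym eq) (mate-loopless d)
    ... | tri> _ _ gt = proj₁ found , inj₂ (proj₂ found)
      where
      found = index (mate d) (subst (λ d′ → proj₁ (mate d) Fin.< proj₁ d′) (sym (mate-mate d)) gt)

    edge : Dart (Fin n) → Fin _
    edge d = proj₁ (located d)

  toGraph : Graph
  toGraph = record
    { n = n
    ; ends = λ e → proj₁ (tail e) , proj₁ (mate (tail e))
    ; loopless = λ e → mate-loopless (tail e) ∘ sym }

  private
    -- The mate of a forward dart points backward and is never a tail, so the hypothesis is absurd.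
    tail-mate : ∀ {e e′} → tail e ≡ mate (tail e′) → e ≡ e′
    tail-mate {e} {e′} eq = contradiction (tail-forward e) (<-asym lt)
      where
      lt : proj₁ (mate (tail e)) Fin.< proj₁ (tail e)
      lt = subst₂ (λ d d′ → proj₁ d Fin.< proj₁ d′)
        (trans (sym (mate-mate (tail e′))) (cong mate (sym eq))) (sym eq) (tail-forward e′)

    determined : ∀ {e e′ d} → tail e ≡ d ⊎ tail e ≡ mate d → tail e′ ≡ d ⊎ tail e′ ≡ mate d → e ≡ e′
    determined (inj₁ p) (inj₁ q) = tail-injective (trans p (sym q))
    determined (inj₂ p) (inj₂ q) = tail-injective (trans p (sym q))
    determined (inj₁ p) (inj₂ q) = sym (tail-mate (trans q (cong mate (sym p))))
    determined (inj₂ p) (inj₁ q) = tail-mate (trans p (cong mate (sym q)))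

    edge-tail : ∀ {e d} → tail e ≡ d ⊎ tail e ≡ mate d → edge d ≡ e
    edge-tail {e} {d} at-d = determined (proj₂ (located d)) at-d

    complete : ∀ {e v} → incident toGraph e v ≡ true → ∃ λ i → edge (v , i) ≡ e
    complete {e} {v} inc with incident⇒end toGraph e v inc
    ... | inj₁ refl = proj₂ (tail e) , edge-tail (inj₁ refl)
    ... | inj₂ refl = proj₂ (mate (tail e)) , edge-tail (inj₂ (sym (mate-mate (tail e))))

    mate-moves : ∀ {v i j} → (v , i) ≢ mate (v , j)
    mate-moves {v} {j = j} eq = mate-loopless (v , j) (cong proj₁ (sym eq))

    edge-injective : ∀ {v i j} → edge (v , i) ≡ edge (v , j) → i ≡ j
    edge-injective {v} {i} {j} eq
      with located (v , i) | located (v , j)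
    edge-injective refl | e , inj₁ p | _ , inj₁ q = cong proj₂ (trans (sym p) q)
    edge-injective refl | e , inj₂ p | _ , inj₂ q = cong proj₂ (mate-injective (trans (sym p) q))
    edge-injective refl | e , inj₁ p | _ , inj₂ q = contradiction (trans (sym p) q) mate-moves
    edge-injective refl | e , inj₂ p | _ , inj₁ q = contradiction (trans (sym q) p) mate-moves

    swap-orbit : ∀ {e d} → tail e ≡ d ⊎ tail e ≡ mate d → tail e ≡ mate d ⊎ tail e ≡ mate (mate d)
    swap-orbit {d = d} (inj₁ p) = inj₂ (trans p (sym (mate-mate d)))
    swap-orbit (inj₂ p) = inj₁ p

    edge-incident : ∀ d → incident toGraph (edge d) (proj₁ d) ≡ true
    edge-incident d with located d
    ... | e , inj₁ p = joins⇒incident toGraph {e} (inj₁ (cong proj₁ p , refl))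
    ... | e , inj₂ p = joins⇒incident toGraph {e}
            (inj₂ (trans (cong (proj₁ ∘ mate) p) (cong proj₁ (mate-mate d)) , refl))

  toGraph-presentation : Presentation toGraph D
  toGraph-presentation = record
    { edge = edge
    ; edge-incident = edge-incident
    ; edge-complete = complete
    ; edge-injective = λ {v} → edge-injective {v}
    ; edge-mate = λ d → edge-tail (swap-orbit (proj₂ (located d))) }

-- Substituting a graph for every vertex.

avoid : ∀ {A : Set} → DecidableEquality A → ∀ {k} {f : Fin (suc k) → A} → Injective _≡_ _≡_ f →
        ∀ a → ∃ λ i → ∀ j → j ≢ i → f j ≢ a
avoid _≟A_ {f = f} f-inj a with any? (λ i → f i ≟A a)
... | yes (i , refl) = i , λ j j≢i eq → j≢i (f-inj eq)
-- Nothing has to be avoided, so any index serves.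
... | no none = zero , λ j _ eq → none (j , eq)

module Substitution {V : Set} (_≟V_ : DecidableEquality V) (B : DartGraph V)
                    {w : ℕ} (G : DartGraph (Fin (suc w))) where
  private
    module B = DartGraph B
    module G = DartGraph G

  lift : Dart (Fin w) → Dart (Fin (suc w))
  lift (v , i) = suc v , i

  lift-injective : ∀ {d d′} → lift d ≡ lift d′ → d ≡ d′
  lift-injective refl = refl

  private
    unlift : ∀ d → proj₁ d ≢ zero → ∃ λ d′ → d ≡ lift d′
    unlift (zero  , _) ≢zero = contradiction refl ≢zero
    unlift (suc v , i) _     = (v , i) , refl

  -- The end, inside `G` minus its root, of the root edge at dart `j`. In the copy at `b` this dart
  -- carries the edge of `B` at `(b , j)` instead.
  port : Fin 3 → Dart (Fin w)
  port j = proj₁ (unlift (G.mate (zero , j)) (G.mate-loopless (zero , j)))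

  mate-root : ∀ j → G.mate (zero , j) ≡ lift (port j)
  mate-root j = proj₂ (unlift (G.mate (zero , j)) (G.mate-loopless (zero , j)))

  mate-port : ∀ j → G.mate (lift (port j)) ≡ (zero , j)
  mate-port j = trans (cong G.mate (sym (mate-root j))) (G.mate-mate (zero , j))

  mate-zero⇒port : ∀ {d j} → G.mate (lift d) ≡ (zero , j) → port j ≡ d
  mate-zero⇒port {d} {j} eq = lift-injective
    (trans (sym (mate-root j)) (trans (cong G.mate (sym eq)) (G.mate-mate (lift d))))

  at : V → Dart (Fin w) → Dart (V × Fin w)
  at b (v , i) = (b , v) , i

  enter : Dart V → Dart (V × Fin w)
  enter (b , j) = at b (port j)

  -- Reads a dart of `G` from inside the copy at `b`. A dart at the root stands for having left the
  -- copy along `(b , j)`, so it becomes the port on the far side of that edge of `B`.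
  route : V → Dart (Fin (suc w)) → Dart (V × Fin w)
  route b (suc v , i) = at b (v , i)
  route b (zero  , j) = enter (B.mate (b , j))

  mate : Dart (V × Fin w) → Dart (V × Fin w)
  mate ((b , v) , i) = route b (G.mate (suc v , i))

  mate-enter : ∀ d → mate (enter d) ≡ enter (B.mate d)
  mate-enter (b , j) = cong (route b) (mate-port j)

  private
    mate-route : ∀ b d {v i} → G.mate d ≡ (suc v , i) → mate (route b d) ≡ at b (v , i)
    mate-route b (suc _ , _) eq = cong (route b) eq
    mate-route b (zero  , j) eq = trans (mate-enter (B.mate (b , j)))
      (trans (cong enter (B.mate-mate (b , j)))
        (cong (at b) (lift-injective (trans (sym (mate-root j)) eq))))

    route-loopless : ∀ b d {v i} → G.mate d ≡ (suc v , i) → proj₁ (route b d) ≢ (b , v)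
    route-loopless b (suc _ , i) eq refl = G.mate-loopless (suc _ , i) (cong proj₁ eq)
    route-loopless b (zero  , j) eq eq′ = B.mate-loopless (b , j) (cong proj₁ eq′)

  -- B with every vertex replaced by a copy of G minus its vertex zero.
  substitute : DartGraph (V × Fin w)
  substitute = record
    { mate = mate
    ; mate-mate = λ { ((b , v) , i) → mate-route b (G.mate (suc v , i)) (G.mate-mate (suc v , i)) }
    ; mate-loopless = λ { ((b , v) , i) → route-loopless b (G.mate (suc v , i)) (G.mate-mate (suc v , i)) } }

  private
    module H = DartGraph substitute

  module _ (connectedB : B.TriplyConnected) (connectedG : G.TriplyConnected)
           {f : Fin 4 → V} (f-inj : Injective _≡_ _≡_ f)
           {g : Fin 4 → Fin (suc w)} (g-inj : Injective _≡_ _≡_ g) where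

    private
      portVertex : Fin 3 → Fin w
      portVertex j = proj₁ (port j)

      -- Two ports at one vertex would give the root of `G` two equal neighbours.
      portVertex-injective : Injective _≡_ _≡_ portVertex
      portVertex-injective {i} {j} eq = neighbour-injective _≟_ G connectedG g-inj
        (trans (cong proj₁ (mate-root i)) (trans (cong suc eq) (sym (cong proj₁ (mate-root j)))))

      -- At most one index has its port at `a` and at most one leads to `c`; three indices leave
      -- another.
      gates : ∀ b c a → ∃ λ j → portVertex j ≢ a × B.neighbour b j ≢ c
      gates b c a =
        let i , not-a = avoid _≟_ portVertex-injective a
            k , not-c = avoid _≟V_ (neighbour-injective _≟V_ B connectedB f-inj {b}) c
            j , j∉ = outside-Fin (i ∷ k ∷ []) (s≤s (s≤s (s≤s z≤n)))
        in j , not-a j (j∉ ∘ here) , not-c j (j∉ ∘ there ∘ here)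

      module Connect (live : V × Fin w → Bool) where

        -- The live set induced on `G` by the copy at `b`. A dead root confines paths to the copy; a
        -- live root is the target of paths that leave it.
        block : V → Bool → Fin (suc w) → Bool
        block b root zero    = root
        block b root (suc v) = live (b , v)

        inner-step : ∀ {b v v′ i} → G.neighbour (suc v) i ≡ suc v′ → H.neighbour (b , v) i ≡ (b , v′)
        inner-step {v = v} {i = i} eq with G.mate (suc v , i)
        inner-step refl | suc _ , _ = refl

        -- With the root dead no step can use it, so the whole path stays in the copy.
        within : ∀ {b u v} → G.Linked (block b false) (suc u) (suc v) → H.Linked live (b , u) (b , v)
        within-suc : ∀ {b s u v} → s ≡ suc u → G.Linked (block b false) s (suc v) →
                     H.Linked live (b , u) (b , v)
        within = within-suc refl
        within-suc refl ε = ε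
        within-suc refl (_◅_ {j = zero}  (_ , () , _) _)
        within-suc refl (_◅_ {j = suc _} (lu , lv , i , eq) p) =
          (lu , lv , i , inner-step eq) ◅ within-suc refl p

        -- The path is cut at its first visit to the root; the vertex just before is the far end of
        -- a root edge, hence a port vertex.
        escape : ∀ {b v} → G.Linked (block b true) (suc v) zero →
                 ∃ λ j → live (b , portVertex j) ≡ true × H.Linked live (b , v) (b , portVertex j)
        escape {b} {v} (_◅_ {j = zero} (lv , _ , i , eq) _) with G.mate (suc v , i) in mate≡
        escape {b} {v} (_◅_ {j = zero} (lv , _ , i , refl) _) | _ , j =
          j , trans (cong live at-port) lv , subst (H.Linked live (b , v)) (sym at-port) ε
          where
          at-port : (b , portVertex j) ≡ (b , v)
          at-port = cong (λ d → b , proj₁ d) (mate-zero⇒port mate≡)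
        escape (_◅_ {j = suc _} (lu , lv , i , eq) p) =
          let j , lj , q = escape p in j , lj , (lu , lv , i , inner-step eq) ◅ q

        cross : ∀ {b j} → live (b , portVertex j) ≡ true →
                (∀ v → live (B.neighbour b j , v) ≡ true) →
                ∃ λ v → H.Linked live (b , portVertex j) (B.neighbour b j , v)
        cross {b} {j} lj l′ = _ , (lj , l′ _ , proj₂ (port j) , cong proj₁ (mate-enter (b , j))) ◅ ε

        module _ (b₁ b₂ : V) (x₁ x₂ : Fin w)
                 (only : ∀ u → u ≢ (b₁ , x₁) → u ≢ (b₂ , x₂) → live u ≡ true) where

          -- Marks the blocks that are certain to be intact. At most two are excluded, so the
          -- 3-connectedness of `B` applies to the rest.
          clean : V → Bool
          clean = except _≟V_ b₁ b₂

          clean-live : ∀ {b} → clean b ≡ true → ∀ v → live (b , v) ≡ true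
          clean-live cb v = only _ (proj₁ (except-≢ _≟V_ cb) ∘ cong proj₁)
                                   (proj₂ (except-≢ _≟V_ cb) ∘ cong proj₁)

          clean-block : ∀ {b u v} → clean b ≡ true → H.Linked live (b , u) (b , v)
          clean-block {b} {u} {v} cb = within (connectedG (block b false) zero zero
            (λ { zero ≢0 _ → contradiction refl ≢0 ; (suc v) _ _ → clean-live cb v })
            (clean-live cb u) (clean-live cb v))

          clean-path : ∀ {b b′ u v} → clean b′ ≡ true → B.Linked clean b b′ →
                       H.Linked live (b , u) (b′ , v)
          clean-path cb′ ε = clean-block cb′
          clean-path {b} cb′ ((cb , cb″ , j , refl) ◅ p) =
            clean-block cb ◅◅ proj₂ (cross (clean-live cb (portVertex j)) (clean-live cb″)) ◅◅ clean-path cb′ p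

          Exits : V × Fin w → Set
          Exits u = ∃ λ b → ∃ λ v → clean b ≡ true × H.Linked live u (b , v)

          leave : ∀ {b v} j → clean (B.neighbour b j) ≡ true → live (b , portVertex j) ≡ true →
                  H.Linked live (b , v) (b , portVertex j) → Exits (b , v)
          leave {b} j cb′ lj p =
            let v′ , q = cross {b} {j} lj (clean-live cb′) in B.neighbour b j , v′ , cb′ , p ◅◅ q

          -- x is the only deleted vertex of block b, and c is the only
          -- other block with a deleted vertex: leave b through a gate
          -- distinct from x that does not lead to c.
          exit-one : ∀ b c x → (∀ v → v ≢ x → live (b , v) ≡ true) →
                     (∀ b′ → b′ ≢ b → b′ ≢ c → clean b′ ≡ true) →
                     ∀ {v} → live (b , v) ≡ true → Exits (b , v)
          exit-one b c x only-x others {v} lv = through (gates b c x)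
            where
            through : (∃ λ j → portVertex j ≢ x × B.neighbour b j ≢ c) → Exits (b , v)
            -- The root and `x` are the two vertices deleted from `G`, as many as its
            -- 3-connectedness permits.
            through (j , j≢x , j≢c) = leave {b} j cb′ (only-x (portVertex j) j≢x)
              (within (connectedG (block b false) zero (suc x)
                (λ { zero ≢0 _ → contradiction refl ≢0 ; (suc v) _ ≢x → only-x v (≢x ∘ cong suc) })
                lv (only-x (portVertex j) j≢x)))
              where
              cb′ : clean (B.neighbour b j) ≡ true
              cb′ = others (B.neighbour b j) (B.mate-loopless (b , j)) j≢c

          -- All deleted vertices lie in block b₁: walk towards the root
          -- of its copy of G.
          exit-all : b₁ ≡ b₂ → ∀ {v} → live (b₁ , v) ≡ true → Exits (b₁ , v)
          -- Both permitted deletions are spent on `x₁` and `x₂`, so the root has to stay live and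
          -- serves as the target.
          exit-all refl {v} lv = through (escape {b₁} (connectedG (block b₁ true) (suc x₁) (suc x₂)
              (λ { zero _ _ → refl
                 ; (suc v) ≢x₁ ≢x₂ → only (b₁ , v) (≢x₁ ∘ cong suc ∘ cong proj₂) (≢x₂ ∘ cong suc ∘ cong proj₂) })
              lv refl))
            where
            through : (∃ λ j → live (b₁ , portVertex j) ≡ true × H.Linked live (b₁ , v) (b₁ , portVertex j)) →
                      Exits (b₁ , v)
            through (j , lj , p) = leave {b₁} j
              (except-true _≟V_ (B.mate-loopless (b₁ , j)) (B.mate-loopless (b₁ , j))) lj p

          exit : ∀ u → live u ≡ true → Exits u
          exit (b , v) lu with b ≟V b₁ | b ≟V b₂ | b₁ ≟V b₂
          ... | no b≢b₁ | no b≢b₂ | _ = b , v , except-true _≟V_ b≢b₁ b≢b₂ , ε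
          ... | yes refl | _ | yes b₁≡b₂ = exit-all b₁≡b₂ lu
          ... | no b≢b₁ | yes refl | yes b₁≡b₂ = contradiction (sym b₁≡b₂) b≢b₁
          ... | yes refl | _ | no b₁≢b₂ = exit-one b₁ b₂ x₁
            (λ v v≢x₁ → only _ (v≢x₁ ∘ cong proj₂) (b₁≢b₂ ∘ cong proj₁)) (λ _ → except-true _≟V_) lu
          ... | no _ | yes refl | no b₁≢b₂ = exit-one b₂ b₁ x₂
            (λ v v≢x₂ → only _ (b₁≢b₂ ∘ sym ∘ cong proj₁) (v≢x₂ ∘ cong proj₂)) (λ _ ≢b₂ ≢b₁ → except-true _≟V_ ≢b₁ ≢b₂) lu

          -- Both ends walk to intact blocks, which are joined along a path of `B` avoiding `b₁` and
          -- `b₂`.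
          connect : ∀ {u v} → live u ≡ true → live v ≡ true → H.Linked live u v
          connect {u} {v} lu lv =
            let b , _ , cb , p = exit u lu
                b′ , _ , cb′ , q = exit v lv
            in p ◅◅ clean-path cb′ (connectedB clean b₁ b₂ (λ _ → except-true _≟V_) cb cb′) ◅◅ H.link-sym q

    substitute-connected : H.TriplyConnected
    substitute-connected live (b₁ , x₁) (b₂ , x₂) only = Connect.connect live b₁ b₂ x₁ x₂ only

-- Relabelling vertices and the tower of inflations.

module Relabel {V W : Set} (to : V → W) (from : W → V)
               (to-from : ∀ x → to (from x) ≡ x) (from-to : ∀ v → from (to v) ≡ v)
               (D : DartGraph V) where
  open DartGraph D

  rename : Dart V → Dart W
  rename (v , i) = to v , i

  private
    unname : Dart W → Dart V
    unname (x , i) = from x , i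

    rename-unname : ∀ d → rename (unname d) ≡ d
    rename-unname (x , i) = cong (_, i) (to-from x)

    unname-rename : ∀ d → unname (rename d) ≡ d
    unname-rename (v , i) = cong (_, i) (from-to v)

  relabel : DartGraph W
  relabel = record
    { mate = λ d → rename (mate (unname d))
    ; mate-mate = λ d → trans (cong (rename ∘ mate) (unname-rename (mate (unname d))))
        (trans (cong rename (mate-mate (unname d))) (rename-unname d))
    ; mate-loopless = λ d eq → mate-loopless (unname d)
        (trans (sym (from-to _)) (cong from eq)) }

  mate-rename : ∀ d → DartGraph.mate relabel (rename d) ≡ rename (mate d)
  mate-rename d = cong (rename ∘ mate) (unname-rename d)

  relabel-connected : TriplyConnected → DartGraph.TriplyConnected relabel
  relabel-connected connected live x y only {u} {v} lu lv =
    subst₂ (DartGraph.Linked relabel live) (to-from u) (to-from v)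
      (gmap to (λ { {v} (lv , lv′ , i , refl) → lv , lv′ , i , cong (λ v → to (neighbour v i)) (from-to v) })
        (connected (live ∘ to) (from x) (from y)
          (λ v ≢x ≢y → only (to v) (λ eq → ≢x (trans (sym (from-to v)) (cong from eq)))
                                   (λ eq → ≢y (trans (sym (from-to v)) (cong from eq))))
          (trans (cong live (to-from u)) lu) (trans (cong live (to-from v)) lv)))

module _ {w : ℕ} (G : DartGraph (Fin (suc w))) where

  -- Pairs are renumbered by `Fin` so that the result can be inflated again and turned into a graph.
  inflate : ∀ {n} → DartGraph (Fin n) → DartGraph (Fin (n * w))
  inflate {n} B = Relabel.relabel (λ (b , v) → combine b v) (remQuot {n} w)
    (combine-remQuot {n} w) (λ (b , v) → remQuot-combine b v) (Substitution.substitute _≟_ B G)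

  module _ (connectedG : DartGraph.TriplyConnected G) (3<1+w : 3 < suc w) where

    inflate-connected : ∀ {n} (B : DartGraph (Fin n)) → 3 < n → DartGraph.TriplyConnected B →
                        DartGraph.TriplyConnected (inflate B)
    inflate-connected {n} B 3<n connectedB = Relabel.relabel-connected (λ (b , v) → combine b v) (remQuot {n} w)
      (combine-remQuot {n} w) (λ (b , v) → remQuot-combine b v) (Substitution.substitute _≟_ B G)
      (Substitution.substitute-connected _≟_ B G connectedB connectedG
        (inject≤-injective 3<n 3<n _ _) (inject≤-injective 3<1+w 3<1+w _ _))

    -- Each round multiplies the vertex number by `w`, which exceeds 1. The bound `3 < n` is carried
    -- along because `inflate-connected` asks for four vertices of `B`.
    tower : ∀ k → ∃ λ n → Σ (DartGraph (Fin n)) λ B → DartGraph.TriplyConnected B × 3 < n × k ≤ n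
    tower zero = suc w , G , connectedG , 3<1+w , z≤n
    tower (suc k) with tower k
    ... | n , B , connectedB , 3<n , k≤n =
      n * w , inflate B , inflate-connected B 3<n connectedB , ℕ.<-trans 3<n n<n*w , ℕ.≤-<-trans k≤n n<n*w
      where
      n<n*w : n < n * w
      n<n*w = ℕ.m<m*n n w ⦃ >-nonZero (ℕ.<-trans z<s 3<n) ⦄ (ℕ.≤-pred (ℕ.<-trans (s≤s (s≤s (s≤s z≤n))) 3<1+w))

-- Colourings of darts and greedy recolouring.

Symmetric : ∀ {V} → DartGraph V → (Dart V → Fin 5) → Set
Symmetric D κ = ∀ d → κ (DartGraph.mate D d) ≡ κ d

-- Only clashes between two darts of `A` are excluded, which describes a colouring that is proper
-- apart from some edges still to be repaired.
ProperOn : ∀ {V} → (Dart V → Set) → (Dart V → Fin 5) → Set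
ProperOn A κ = ∀ {v i j} → i ≢ j → A (v , i) → A (v , j) → κ (v , i) ≢ κ (v , j)

module Recolouring {V : Set} (_≟V_ : DecidableEquality V) (D : DartGraph V) where
  open DartGraph D

  private
    _≟D_ : DecidableEquality (Dart V)
    _≟D_ = ≡-dec _≟V_ _≟_

  OnEdge : Dart V → Dart V → Set
  OnEdge d x = x ≡ d ⊎ x ≡ mate d

  onEdge? : ∀ d x → Dec (OnEdge d x)
  onEdge? d x = (x ≟D d) ⊎-dec (x ≟D mate d)

  OnEdge-mate : ∀ {d x} → OnEdge d x → OnEdge d (mate x)
  OnEdge-mate (inj₁ refl) = inj₂ refl
  OnEdge-mate {d} (inj₂ refl) = inj₁ (mate-mate d)

  OnEdge-mate⁻ : ∀ {d x} → OnEdge d (mate x) → OnEdge d x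
  OnEdge-mate⁻ {d} {x} = subst (OnEdge d) (mate-mate x) ∘ OnEdge-mate

  OnEdge-unique : ∀ {d v i j} → OnEdge d (v , i) → OnEdge d (v , j) → i ≡ j
  OnEdge-unique (inj₁ p) (inj₁ q) = cong proj₂ (trans p (sym q))
  OnEdge-unique (inj₂ p) (inj₂ q) = cong proj₂ (trans p (sym q))
  OnEdge-unique {d} (inj₁ refl) (inj₂ q) = contradiction (cong proj₁ (sym q)) (mate-loopless d)
  OnEdge-unique {d} (inj₂ p) (inj₁ refl) = contradiction (cong proj₁ (sym p)) (mate-loopless d)

  others : Dart V → List (Dart V)
  others (v , i) = (v , punchIn i zero) ∷ (v , punchIn i (suc zero)) ∷ []

  ∈-others : ∀ {v i j} → i ≢ j → (v , j) ∈ others (v , i)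
  ∈-others {v} {i} {j} i≢j with punchOut i≢j | punchIn-punchOut i≢j
  ... | zero     | refl = here refl
  ... | suc zero | refl = there (here refl)

  module _ {A A′ : Dart V → Set} (κ : Dart V → Fin 5) (d : Dart V)
           (κ-sym : Symmetric D κ) (κ-proper : ProperOn A κ)
           (A′⊆A : ∀ x → A′ x → ¬ OnEdge d x → A x) where

    private
      adjacent : List (Dart V)
      adjacent = others d ++ others (mate d)

      adjacent⁺ : ∀ {v i j} → OnEdge d (v , i) → i ≢ j → (v , j) ∈ adjacent
      adjacent⁺ (inj₁ refl) i≢j = ∈ₗ.∈-++⁺ˡ (∈-others i≢j)
      adjacent⁺ {v} {i} {j} (inj₂ eq) i≢j = ∈ₗ.∈-++⁺ʳ (others d)
        (subst (λ x → (v , j) ∈ others x) eq (∈-others i≢j))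

      module Paint (a : Fin 5) (a∉ : a ∉ map κ adjacent) where
        -- The decision is an argument, so that the new colour can be analysed by cases on it.
        paint : ∀ {x} → Dec (OnEdge d x) → Fin 5
        paint (yes _)    = a
        paint {x} (no _) = κ x

        κ′ : Dart V → Fin 5
        κ′ x = paint (onEdge? d x)

        on-a : ∀ {x} → OnEdge d x → κ′ x ≡ a
        on-a {x} on = go (onEdge? d x)
          where
          go : ∀ dec → paint dec ≡ a
          go (yes _)  = refl
          go (no off) = contradiction on off

        off-κ : ∀ x → ¬ OnEdge d x → κ′ x ≡ κ x
        off-κ x off = go (onEdge? d x)
          where
          go : ∀ dec → paint {x} dec ≡ κ x
          go (yes on) = contradiction on off
          go (no _)   = refl

        κ′-sym : Symmetric D κ′
        κ′-sym x = go (onEdge? d x)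
          where
          go : Dec (OnEdge d x) → κ′ (mate x) ≡ κ′ x
          go (yes on) = trans (on-a (OnEdge-mate on)) (sym (on-a on))
          go (no off) = trans (off-κ (mate x) (off ∘ OnEdge-mate⁻)) (trans (κ-sym x) (sym (off-κ x off)))

        clash : ∀ {v i j} → OnEdge d (v , i) → i ≢ j → a ≢ κ (v , j)
        clash on i≢j eq = a∉ (subst (_∈ map κ adjacent) (sym eq) (∈ₗ.∈-map⁺ κ (adjacent⁺ on i≢j)))

        κ′-proper : ProperOn A′ κ′
        κ′-proper {v} {i} {j} i≢j ai aj eq = go (onEdge? d (v , i)) (onEdge? d (v , j))
          where
          go : Dec (OnEdge d (v , i)) → Dec (OnEdge d (v , j)) → ⊥
          go (yes on) (yes on′) = i≢j (OnEdge-unique on on′)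
          go (yes on) (no off′) = clash on i≢j (trans (sym (on-a on)) (trans eq (off-κ _ off′)))
          go (no off) (yes on′) = clash on′ (i≢j ∘ sym) (trans (sym (on-a on′)) (trans (sym eq) (off-κ _ off)))
          go (no off) (no off′) = κ-proper i≢j (A′⊆A _ ai off) (A′⊆A _ aj off′)
            (trans (sym (off-κ _ off)) (trans eq (off-κ _ off′)))

    -- An edge has only four adjacent edges, so some fifth colour is free for it.
    recolour : ∃ λ κ′ → Symmetric D κ′ × (∀ x → ¬ OnEdge d x → κ′ x ≡ κ x) × ProperOn A′ κ′
    recolour with outside-Fin (map κ adjacent) (s≤s (s≤s (s≤s (s≤s (s≤s z≤n)))))
    ... | a , a∉ = κ′ , κ′-sym , off-κ , κ′-proper
      where open Paint a a∉

-- Abnormal edges seen from darts.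

true⇒holds : ∀ {A : Set} (a? : Dec A) → does a? ≡ true → A
true⇒holds (yes a) _ = a

palette : (Fin 3 → Fin 5) → Subset 5
palette κ = Vec.tabulate λ k → does (any? λ i → κ i ≟ k)

palette-cong : ∀ {κ κ′} → (∀ i → κ i ≡ κ′ i) → palette κ ≡ palette κ′
palette-cong {κ} {κ′} eq = Vecₚ.tabulate-cong λ k →
  does-⇔ (mk⇔ (λ (i , p) → i , trans (sym (eq i)) p) (λ (i , p) → i , trans (eq i) p))
    (any? λ i → κ i ≟ k) (any? λ i → κ′ i ≟ k)

abnormalSize : ℕ → Bool
abnormalSize s = not (does (s ℕ.≟ 3)) ∧ not (does (s ℕ.≟ 5))

-- The counterpart of `unionSize` on darts. It sees only the palettes at the two ends, which makes
-- abnormality a local property.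
spread : ∀ {V} → DartGraph V → (Dart V → Fin 5) → Dart V → ℕ
spread D κ d = ∣ palette (λ i → κ (proj₁ d , i)) ∪ palette (λ i → κ (proj₁ (mate d) , i)) ∣
  where open DartGraph D

module _ {G : Graph} {D : DartGraph (Fin (Graph.n G))} (P : Presentation G D) (c : EdgeColoring5 G) where
  open Graph G
  open DartGraph D
  open Presentation P

  S≡palette : ∀ v → S G c v ≡ palette (λ i → c (edge (v , i)))
  S≡palette v = Vecₚ.tabulate-cong λ k → Bool.⇔→≡ (mk⇔ (to k) (from k))
    where
    carries : Fin 5 → Fin m → Bool
    carries k e = incident G e v ∧ does (c e ≟ k)
    to : ∀ k → any (carries k) (allFin m) ≡ true → does (any? λ i → c (edge (v , i)) ≟ k) ≡ true
    to k eq with Any.satisfied (Anyₚ.any⁻ (carries k) (allFin m) (Equivalence.from Bool.T-≡ eq))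
    ... | e , t with Equivalence.to Bool.T-∧ t
    ... | inc , col with edge-complete {e} {v} (Equivalence.to Bool.T-≡ inc)
    ... | i , refl = dec-true (any? λ i → c (edge (v , i)) ≟ k) (i , true⇒holds (c (edge (v , i)) ≟ k) (Equivalence.to Bool.T-≡ col))
    from : ∀ k → does (any? λ i → c (edge (v , i)) ≟ k) ≡ true → any (carries k) (allFin m) ≡ true
    from k eq with true⇒holds (any? λ i → c (edge (v , i)) ≟ k) eq
    ... | i , refl = Equivalence.to Bool.T-≡ (Anyₚ.any⁺ (carries k)
      (lose (∈ₗ.∈-tabulate⁺ (edge (v , i))) (Equivalence.from Bool.T-≡ carried)))
      where
      carried : carries k (edge (v , i)) ≡ true
      carried rewrite edge-incident (v , i) = dec-true (c (edge (v , i)) ≟ k) refl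

  unionSize≡spread : ∀ d → unionSize G c (edge d) ≡ spread D (c ∘ edge) d
  unionSize≡spread d with edge-joins d
  ... | inj₁ (p , q) = cong ∣_∣ (cong₂ _∪_ (trans (cong (S G c) p) (S≡palette _)) (trans (cong (S G c) q) (S≡palette _)))
  ... | inj₂ (p , q) = cong ∣_∣ (trans (∪-comm (S G c (proj₁ (Graph.ends G (edge d)))) _)
          (cong₂ _∪_ (trans (cong (S G c) p) (S≡palette _)) (trans (cong (S G c) q) (S≡palette _))))

AbnormalDart : ∀ {V} → DartGraph V → (Dart V → Fin 5) → Dart V → Set
AbnormalDart D κ d = abnormalSize (spread D κ d) ≡ true

-- The list has to meet each abnormal edge in one of its two darts. It may repeat edges or contain
-- normal ones, so its length is an upper bound.
SevenAbnormal : ∀ {V} → DartGraph V → Set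
SevenAbnormal {V} D = ∃ λ κ → Symmetric D κ × ProperOn (λ _ → ⊤) κ ×
  ∃ λ ds → length ds ≡ 7 × (∀ d → AbnormalDart D κ d → d ∈ ds ⊎ DartGraph.mate D d ∈ ds)

spread-cong : ∀ {V W} (D : DartGraph V) (D′ : DartGraph W) κ κ′ d d′ →
              (∀ i → κ (proj₁ d , i) ≡ κ′ (proj₁ d′ , i)) →
              (∀ i → κ (proj₁ (DartGraph.mate D d) , i) ≡ κ′ (proj₁ (DartGraph.mate D′ d′) , i)) →
              spread D κ d ≡ spread D′ κ′ d′
spread-cong D D′ κ κ′ d d′ eq eq′ = cong ∣_∣ (cong₂ _∪_ (palette-cong eq) (palette-cong eq′))

module _ {G : Graph} {D : DartGraph (Fin (Graph.n G))} (P : Presentation G D) where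
  open Graph G
  open DartGraph D
  open Presentation P

  proper-darts : ∀ {c} → Proper G c → ProperOn (λ _ → ⊤) (c ∘ edge)
  proper-darts proper {v} {i} {j} i≢j _ _ = proper (edge (v , i)) (edge (v , j)) v
    (i≢j ∘ edge-injective) (edge-incident (v , i)) (edge-incident (v , j))

  sevenAbnormal⇒colouring : SevenAbnormal D → Σ (EdgeColoring5 G) λ c → Proper G c × abnormalCount G c ≤ 7
  sevenAbnormal⇒colouring (κ , κ-sym , κ-proper , ds , length-ds , ds-complete) = c , c-proper , c-count
    where
    c : EdgeColoring5 G
    -- `dart e` picks one of the two darts; the symmetry of `κ` makes the choice immaterial.
    c e = κ (proj₁ (dart e))
    c-edge : ∀ d → c (edge d) ≡ κ d
    c-edge d = go (edge-orbit (proj₂ (dart (edge d))))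
      where
      go : ∀ {d′} → d′ ≡ d ⊎ d′ ≡ mate d → κ d′ ≡ κ d
      go (inj₁ eq) = cong κ eq
      go (inj₂ eq) = trans (cong κ eq) (κ-sym d)
    c-proper : Proper G c
    c-proper e e′ v e≢e′ inc inc′ eq with edge-complete {e} inc | edge-complete {e′} inc′
    ... | i , refl | j , refl = κ-proper (e≢e′ ∘ cong (λ i → edge (v , i))) tt tt
      (trans (sym (c-edge (v , i))) (trans eq (c-edge (v , j))))
    size≡spread : ∀ d → unionSize G c (edge d) ≡ spread D κ d
    size≡spread d = trans (unionSize≡spread P c d) (spread-cong D D (c ∘ edge) κ d d (λ i → c-edge _) (λ i → c-edge _))
    listed : ∀ {d} → d ∈ ds ⊎ mate d ∈ ds → edge d ∈ map edge ds
    listed (inj₁ d∈) = ∈ₗ.∈-map⁺ edge d∈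
    listed {d} (inj₂ d∈) = subst (_∈ map edge ds) (edge-mate d) (∈ₗ.∈-map⁺ edge d∈)
    covered : ∀ e → abnormalSize (unionSize G c e) ≡ true → e ∈ map edge ds
    covered e abnormal = subst (_∈ map edge ds) eq (listed (ds-complete d
      (trans (cong abnormalSize (trans (sym (size≡spread d)) (cong (unionSize G c) eq))) abnormal)))
      where
      d = proj₁ (dart e)
      eq = proj₂ (dart e)
    c-count : abnormalCount G c ≤ 7
    c-count = ℕ.≤-trans (count≤length (abnormalSize ∘ unionSize G c) (map edge ds) covered)
      (ℕ.≤-reflexive (trans (length-map edge ds) length-ds))

-- Restricting a colouring to one block.

module _ {V : Set} (_≟V_ : DecidableEquality V) (B : DartGraph V)
         {w : ℕ} (D : DartGraph (Fin (suc w))) where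
  open Substitution _≟V_ B D using (port; mate-root; mate-zero⇒port; lift; at; route; substitute)
  open Recolouring _≟_ D
  private
    module D = DartGraph D
    module H = DartGraph substitute

  -- Such edges stay within a copy under substitution, whereas the edges to the root turn into edges
  -- of `B`.
  Inner : Dart (Fin w) → Set
  Inner d = proj₁ (D.mate (lift d)) ≢ zero

  inner-mate : ∀ {b d} → Inner d → ∃ λ d′ → D.mate (lift d) ≡ lift d′ × H.mate (at b d) ≡ at b d′
  inner-mate {b} {d} inner = go (D.mate (lift d)) refl inner
    where
    go : ∀ x → D.mate (lift d) ≡ x → proj₁ x ≢ zero →
         ∃ λ d′ → D.mate (lift d) ≡ lift d′ × H.mate (at b d) ≡ at b d′
    go (zero  , _) _  ≢zero = contradiction refl ≢zero
    go (suc v , i) eq _     = (v , i) , eq , cong (route b) eq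

  module _ (κ : Dart (V × Fin w) → Fin 5) (κ-sym : Symmetric substitute κ) (κ-proper : ProperOn (λ _ → ⊤) κ)
           (b : V) (normal : ∀ d → Inner d → ¬ AbnormalDart substitute κ (at b d)) where

    private
      -- Proper except that the colours at the root may clash.
      κ₀ : Dart (Fin (suc w)) → Fin 5
      κ₀ (suc v , i) = κ (at b (v , i))
      -- Forced by symmetry: the root edge takes the colour of the edge leaving the block at port
      -- `j`.
      κ₀ (zero  , j) = κ (at b (port j))

      κ₀-sym : Symmetric D κ₀
      κ₀-sym (zero , j) = cong κ₀ (mate-root j)
      κ₀-sym (suc v , i) = go (D.mate (suc v , i)) refl
        where
        go : ∀ x → D.mate (suc v , i) ≡ x → κ₀ x ≡ κ (at b (v , i))
        go (suc _ , _) eq = trans (cong κ (sym (cong (route b) eq))) (κ-sym (at b (v , i)))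
        go (zero  , j) eq = cong (κ ∘ at b) (mate-zero⇒port eq)

      -- The root edge at dart `zero` is kept: with the other two free to move, nothing at the root
      -- forces it to change, and no further edges at its far end have to be listed.
      e₁ e₂ : Dart (Fin (suc w))
      e₁ = zero , suc zero
      e₂ = zero , suc (suc zero)

      κ₀-proper : ProperOn (λ x → ¬ OnEdge e₁ x × ¬ OnEdge e₂ x) κ₀
      κ₀-proper {suc v} i≢j _ _ = κ-proper i≢j tt tt
      κ₀-proper {zero} {zero} {zero} i≢j _ _ _ = i≢j refl
      κ₀-proper {zero} {suc zero} _ (off , _) _ _ = off (inj₁ refl)
      κ₀-proper {zero} {suc (suc zero)} _ (_ , off) _ _ = off (inj₁ refl)
      κ₀-proper {zero} {zero} {suc zero} _ _ (off , _) _ = off (inj₁ refl)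
      κ₀-proper {zero} {zero} {suc (suc zero)} _ _ (_ , off) _ = off (inj₁ refl)

      far : Fin 3 → Fin w
      far j = proj₁ (port j)

      rootDarts : List (Dart (Fin (suc w)))
      rootDarts = (zero , zero) ∷ e₁ ∷ e₂ ∷ []

      -- The recoloured edges are already counted among the root darts, so `others` suffices at
      -- their far ends.
      touched : List (Dart (Fin (suc w)))
      touched = rootDarts ++ (others (lift (port (suc zero))) ++ others (lift (port (suc (suc zero)))))

      ∈-root : ∀ j → (zero , j) ∈ touched
      ∈-root zero             = here refl
      ∈-root (suc zero)       = there (here refl)
      ∈-root (suc (suc zero)) = there (there (here refl))

      others⁺ : ∀ {i} x → i ≡ proj₂ x ⊎ (proj₁ x , i) ∈ others x
      others⁺ {i} (v , j) with j ≟ i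
      ... | yes eq = inj₁ (sym eq)
      ... | no ne  = inj₂ (∈-others ne)

      at-far : ∀ j {i} → (∀ {x} → x ∈ others (lift (port j)) → x ∈ touched) →
               (suc (far j) , i) ∈ touched ⊎ D.mate (suc (far j) , i) ∈ touched
      at-far j {i} sub with others⁺ {i} (lift (port j))
      ... | inj₁ refl = inj₂ (subst (_∈ touched) (sym (Substitution.mate-port _≟V_ B D j)) (∈-root j))
      ... | inj₂ x∈   = inj₁ (sub x∈)

      Special : Fin (suc w) → Set
      Special v = v ≡ suc (far (suc zero)) ⊎ v ≡ suc (far (suc (suc zero)))

      special-touched : ∀ {v i} → Special v → (v , i) ∈ touched ⊎ D.mate (v , i) ∈ touched
      special-touched (inj₁ refl) = at-far (suc zero) (∈ₗ.∈-++⁺ʳ rootDarts ∘ ∈ₗ.∈-++⁺ˡ)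
      special-touched (inj₂ refl) = at-far (suc (suc zero))
        (∈ₗ.∈-++⁺ʳ rootDarts ∘ ∈ₗ.∈-++⁺ʳ (others (lift (port (suc zero)))))

      swap-touched : ∀ {d} → D.mate d ∈ touched ⊎ D.mate (D.mate d) ∈ touched → d ∈ touched ⊎ D.mate d ∈ touched
      swap-touched (inj₁ p) = inj₂ p
      swap-touched {d} (inj₂ p) = inj₁ (subst (_∈ touched) (D.mate-mate d) p)

      special? : ∀ v → Dec (Special v)
      special? v = (v ≟ suc (far (suc zero))) ⊎-dec (v ≟ suc (far (suc (suc zero))))

      off-root-edge : ∀ j {v i} → suc v ≢ suc (far j) → ¬ OnEdge (zero , j) (suc v , i)
      off-root-edge j ne (inj₁ ())
      off-root-edge j ne (inj₂ eq) = ne (cong proj₁ (trans eq (mate-root j)))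

      -- Away from the root and from the far ends of `e₁` and `e₂`, both end palettes are those of
      -- the block, so an abnormal edge there would contradict `normal`.
      complete : ∀ {κ₂} → (∀ x → ¬ OnEdge e₁ x → ¬ OnEdge e₂ x → κ₂ x ≡ κ₀ x) →
                 ∀ d → AbnormalDart D κ₂ d → d ∈ touched ⊎ D.mate d ∈ touched
      complete _ (zero , j) _ = inj₁ (∈-root j)
      complete {κ₂} agree (suc v , i) abnormal with D.neighbour (suc v) i ≟ zero
      ... | yes at-root = inj₂ (subst (λ u → (u , proj₂ (D.mate (suc v , i))) ∈ touched) (sym at-root) (∈-root _))
      ... | no inner with special? (suc v) | special? (D.neighbour (suc v) i) | inner-mate {b} {v , i} inner
      ... | yes s | _ | _ = special-touched s
      ... | no _ | yes s | _ = swap-touched (special-touched s)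
      ... | no ¬s | no ¬s′ | (v′ , i′) , mate≡ , mateH≡ = contradiction
        (trans (cong abnormalSize (spread-cong substitute D κ κ₂ (at b (v , i)) (suc v , i)
          (λ k → sym (same ¬s)) same-mate)) abnormal)
        (normal (v , i) inner)
        where
        same : ∀ {u k} → ¬ Special (suc u) → κ₂ (suc u , k) ≡ κ (at b (u , k))
        same ¬s = agree _ (off-root-edge (suc zero) (¬s ∘ inj₁)) (off-root-edge (suc (suc zero)) (¬s ∘ inj₂))
        same-mate : ∀ k → κ (proj₁ (H.mate (at b (v , i))) , k) ≡ κ₂ (proj₁ (D.mate (suc v , i)) , k)
        same-mate k = trans (cong (λ x → κ (proj₁ x , k)) mateH≡)
          (trans (sym (same (subst (¬_ ∘ Special) (cong proj₁ mate≡) ¬s′)))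
                 (cong (λ x → κ₂ (proj₁ x , k)) (sym mate≡)))

    -- The possible clashes shrink in two rounds, first to those involving the edge of `e₂`, then to
    -- none.
    restrict-block : SevenAbnormal D
    restrict-block
      with recolour {A′ = λ x → ¬ OnEdge e₂ x} κ₀ e₁ κ₀-sym κ₀-proper (λ _ off₂ off₁ → off₁ , off₂)
    ... | κ₁ , κ₁-sym , κ₁-off , κ₁-proper
      with recolour {A′ = λ _ → ⊤} κ₁ e₂ κ₁-sym κ₁-proper (λ _ _ off₂ → off₂)
    ... | κ₂ , κ₂-sym , κ₂-off , κ₂-proper =
      κ₂ , κ₂-sym , κ₂-proper , touched , refl ,
      complete (λ x off₁ off₂ → trans (κ₂-off x off₂) (κ₁-off x off₁))

-- Finding a block without abnormal inner edges.

module _ {w : ℕ} (D : DartGraph (Fin (suc w))) {N : ℕ} (B : DartGraph (Fin N)) where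
  open Substitution _≟_ B D using (at; substitute; lift)
  private
    D′ : DartGraph (Fin (N * w))
    D′ = inflate D B

    H : Graph
    H = toGraph D′

    open Graph H using (m)

    PH : Presentation H D′
    PH = toGraph-presentation D′

    open Presentation PH

    module R = Relabel (λ (b , v) → combine {N} {w} b v) (remQuot {N} w)
      (combine-remQuot {N} w) (λ (b , v) → remQuot-combine b v) substitute

    rename-injective : ∀ {d d′} → R.rename d ≡ R.rename d′ → d ≡ d′
    rename-injective {(b , v) , i} {(b′ , v′) , i′} eq = cong₂ _,_
      (trans (sym (remQuot-combine b v)) (trans (cong (remQuot {N} w ∘ proj₁) eq) (remQuot-combine b′ v′)))
      (cong proj₂ eq)

  -- If every block had an abnormal inner edge, one choice per block would give `N` distinct
  -- abnormal edges.
  colouring⇒sevenAbnormal : ∀ c → Proper H c → abnormalCount H c < N → SevenAbnormal D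
  colouring⇒sevenAbnormal c proper few = go (any? (λ b → ¬? (bad? b)))
    where
    abnormal : Fin m → Bool
    abnormal = abnormalSize ∘ unionSize H c

    Bad : Fin N → Set
    Bad b = ∃ λ v → ∃ λ i → Inner _≟_ B D (v , i) × abnormal (edge (R.rename (at b (v , i)))) ≡ true

    bad? : ∀ b → Dec (Bad b)
    bad? b = any? λ v → any? λ i →
      ¬? (proj₁ (DartGraph.mate D (lift (v , i))) ≟ zero) ×-dec (abnormal (edge (R.rename (at b (v , i)))) Bool.≟ true)

    κ : Dart (Fin N × Fin w) → Fin 5
    κ = c ∘ edge ∘ R.rename

    κ-sym : Symmetric substitute κ
    κ-sym d = cong c (trans (cong edge (sym (R.mate-rename d))) (edge-mate (R.rename d)))

    size≡spread : ∀ d → unionSize H c (edge (R.rename d)) ≡ spread substitute κ d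
    size≡spread d = trans (unionSize≡spread PH c (R.rename d))
      (spread-cong D′ substitute (c ∘ edge) κ (R.rename d) d (λ _ → refl)
        (λ i → cong (λ x → c (edge (proj₁ x , i))) (R.mate-rename d)))

    bad-edge : ∀ {b} → Bad b → Fin m
    bad-edge {b} (v , i , _) = edge (R.rename (at b (v , i)))

    -- Both ends of a bad edge lie in its block.
    bad-edge-block : ∀ {b b′} (x : Bad b) (y : Bad b′) → bad-edge x ≡ bad-edge y → b ≡ b′
    bad-edge-block {b} {b′} (v , i , inner , _) (v′ , i′ , inner′ , _) eq
      with edge-orbit eq | inner-mate _≟_ B D {b′} {v′ , i′} inner′
    ... | inj₁ p | _ = cong (proj₁ ∘ proj₁) (rename-injective p)
    ... | inj₂ p | _ , _ , q =
      cong (proj₁ ∘ proj₁) (trans (rename-injective (trans p (R.mate-rename (at b′ (v′ , i′))))) q)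

    all-bad : ¬ (∀ b → Bad b)
    all-bad bad = ℕ.<⇒≱ few (injective⇒≤count abnormal (bad-edge ∘ bad)
      (λ {b} {b′} → bad-edge-block (bad b) (bad b′)) (λ b → proj₂ (proj₂ (proj₂ (bad b)))))

    go : Dec (∃ λ b → ¬ Bad b) → SevenAbnormal D
    go (no all) = contradiction (λ b → decidable-stable (bad? b) λ ¬bad → all (b , ¬bad)) all-bad
    go (yes (b , ¬bad)) = restrict-block _≟_ B D κ κ-sym
      (λ {v} → proper-darts PH proper {combine (proj₁ v) (proj₂ v)}) b
      (λ (v , i) inner abn → ¬bad (v , i , inner , trans (cong abnormalSize (size≡spread (at b (v , i)))) abn))

-- The equivalence of the two bounds.

seven-sublinear : Sublinear (λ _ → 7)
seven-sublinear k = suc k * 7 , λ _ le → le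

sublinear⇒seven : StatementB → StatementA
-- The case split exposes the root `zero` and the number `w` of remaining vertices.
sublinear⇒seven _ record { n = zero } _ (() , _)
sublinear⇒seven (f , sublinear , colour) G@record { n = suc w } cubicG connectedG =
  -- `Sublinear` at `w` gives the factor w + 1, just above the ratio `w` between the vertex numbers
  -- of the inflated graph and of `B`.
  let N₀ , bound = sublinear w
      N , B , connectedB , 3<N , N₀≤N = tower D connectedD 3<1+w N₀
      H = toGraph (inflate D B)
      PH = toGraph-presentation (inflate D B)
      N≤N*w = ℕ.m≤m*n N w ⦃ >-nonZero (ℕ.≤-pred (ℕ.<-trans (s≤s (s≤s z≤n)) 3<1+w)) ⦄
      c , c-proper , c-few = colour H (cubic PH)
        (triplyConnected⇒threeConnected PH (ℕ.<-≤-trans 3<N N≤N*w)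
          (inflate-connected D connectedD 3<1+w B 3<N connectedB))
  in sevenAbnormal⇒colouring (toDartGraph-presentation G cubicG)
       (colouring⇒sevenAbnormal D B c c-proper
         (ℕ.≤-<-trans c-few (small-value 3<N (bound (N * w) (ℕ.≤-trans N₀≤N N≤N*w)))))
  where
  open Presentation using (cubic)
  D : DartGraph (Fin (suc w))
  D = toDartGraph G cubicG
  connectedD : DartGraph.TriplyConnected D
  connectedD = threeConnected⇒triplyConnected (toDartGraph-presentation G cubicG) connectedG
  3<1+w : 3 < suc w
  3<1+w = proj₁ connectedG
  small-value : ∀ {N y} → 3 < N → suc w * y ≤ N * w → y < N
  -- From N <= y would follow (w + 1) N <= (w + 1) y <= N w, impossible for positive N.
  small-value {N} {y} 3<N le = ℕ.≰⇒> λ N≤y → ℕ.<⇒≱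
    (ℕ.m<n+m (w * N) (ℕ.<-trans z<s 3<N))
    (ℕ.≤-trans (ℕ.*-monoʳ-≤ (suc w) N≤y) (ℕ.≤-trans le (ℕ.≤-reflexive (ℕ.*-comm N w))))

theorem3 : StatementA ⇔ StatementB
theorem3 = mk⇔ (λ a → (λ _ → 7) , seven-sublinear , a) sublinear⇒seven
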